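{- Let $N \ge 1$ and $m \ge 0$ be integers, and let $x$ and $y$ be chosen independently and uniformly at random among the $N$-bit integers $\{0,1,\ldots,2^N-1\}$. Then the probability $\pi_m(N)$ that $x +_m y = x + y$ (where $+$ is addition mod $2^N$ and $+_m$ is $m$-truncated addition) is $$\pi_m(N) = a_m(N-1).$$
   Context: Write $N$-bit integers in binary as $x=\sum_{i=0}^{N-1}x_i2^i$, $y=\sum_{i=0}^{N-1}y_i2^i$ with $x_i,y_i\in\{0,1\}$. $x+y$ denotes addition in $\mathbb{Z}/2^N\mathbb{Z}$, and $x\oplus y$ denotes bitwise addition mod $2$, i.e. $\sum_{i=0}^{N-1}((x_i+y_i)\bmod 2)2^i$. Truncated addition: for $1\le i\le N-1$ let $\mathsf{c}_i^{(m)}(x,y)=1$ if there exists an index $j\ge 0$ with $i-m\le j<i$ such that $(x_j,y_j)=(1,1)$ and $x_k+y_k=1$ (sum of integers) for all $j<k<i$; otherwise $\mathsf{c}_i^{(m)}(x,y)=0$. Put $\mathsf{c}^{(m)}=\sum_{i=1}^{N-1}\mathsf{c}_i^{(m)}(x,y)2^i$. The $m$-truncated addition is $x+_m y := x\oplus y\oplus \mathsf{c}^{(m)}$. The number $a_m(j)$: for binary strings $u=(u_{j-1},\ldots,u_0)$ and $v=(v_{j-1},\ldots,v_0)$ of length $j$ chosen independently and uniformly, form the ternary string $(u_{j-1}+v_{j-1},\ldots,u_0+v_0)\in\{0,1,2\}^j$ (digitwise sums as integers, without carrying; positions are labelled from right to left starting from $0$). Let $P(m)=1^m2=11\cdots12$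 be the ternary string of $m$ ones followed on the right by a $2$. Then $a_m(j)$ is the probability that this ternary string does not contain $P(m)$ as a consecutive substring. -}

module Defs where

open import Data.Bool.Base using (if_then_else_)
open import Data.Digit using (Bit; 0b)
open import Data.Fin.Base using (Fin; toℕ)
open import Data.Integer.Base using (+_)
open import Data.List.Base
  using (List; []; _∷_; _++_; [_]; length; filter; applyUpTo; replicate;
         allFin; cartesianProduct; cartesianProductWith)
open import Data.List.Membership.Propositional using (_∈_)
open import Data.List.Membership.Propositional.Properties using (∈-cartesianProductWith⁺; ∈-allFin)
open import Data.List.Properties using (length-tabulate)
open import Data.List.Relation.Binary.Infix.Heterogeneous using (Infix)
open import Data.List.Relation.Binary.Infix.Heterogeneous.Properties using (infix?)
open import Data.List.Relation.Unary.All using ([])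
open import Data.List.Relation.Unary.AllPairs using ([]; _∷_)
open import Data.List.Relation.Unary.Any using (here)
open import Data.List.Relation.Unary.Unique.Propositional using (Unique)
open import Data.List.Relation.Unary.Unique.Propositional.Properties
  using (allFin⁺; cartesianProductWith⁺)
open import Data.Nat.Base
  using (ℕ; zero; suc; _+_; _*_; _∸_; _^_; _≤_; _<_; NonZero)
open import Data.Nat.ListAction using (sum)
open import Data.Nat.DivMod using (_/_; _%_)
open import Data.Nat.Properties
  using (_≟_; _≤?_; _<?_; anyUpTo?; allUpTo?; m^n≢0; m*n≢0)
open import Data.Product.Base using (∃; _×_; _,_)
open import Data.Rational.Base as ℚ using (ℚ)
open import Data.Vec.Base as Vec using (Vec; []; _∷_; toList; zipWith)
open import Data.Vec.Properties using (∷-injective)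
open import Function.Base using (id)
open import Level using (Level)
open import Relation.Binary.Core using (Rel)
open import Relation.Binary.Definitions using (Decidable)
open import Relation.Binary.PropositionalEquality
  using (_≡_; refl; sym; subst)
open import Relation.Nullary.Decidable using (Dec; ¬?; _×-dec_; _→-dec_; does)
open import Relation.Nullary.Negation using (¬_)

private
  variable
    ℓ r : Level
    A : Set ℓ

-- The probability of R u v for u and v independent and uniform on a finite
-- set, i.e. for (u , v) uniform on its square. Ω is to list every element
-- of that set exactly once.

Pr : (Ω : List A) .{{_ : NonZero (length Ω)}} {R : Rel A r} → Decidable R → ℚ
Pr Ω R? =
  ℚ._/_ (+ length (filter (λ (u , v) → R? u v) (cartesianProduct Ω Ω)))
        (length Ω * length Ω) {{m*n≢0 (length Ω) (length Ω)}}

-- N-bit integers are naturals below 2 ^ N, and bit x i is xᵢ in x = Σ xᵢ2ⁱ.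

bit : ℕ → ℕ → ℕ
bit x i = _/_ x (2 ^ i) {{m^n≢0 2 i}} % 2

-- Addition in ℤ/2ᴺℤ, through the representatives 0, …, 2ᴺ − 1.

add : ℕ → ℕ → ℕ → ℕ
add N x y = _%_ (x + y) (2 ^ N) {{m^n≢0 2 N}}

xor : ℕ → ℕ → ℕ → ℕ
xor N x y = sum (applyUpTo (λ i → (bit x i + bit y i) % 2 * 2 ^ i) N)

-- The condition for cᵢ⁽ᵐ⁾(x , y) = 1. As j ≥ 0, the truncated i ∸ m ≤ j says
-- the same as i − m ≤ j over the integers.

Carry : (m x y i : ℕ) → Set
Carry m x y i =
  ∃ λ j → j < i × i ∸ m ≤ j × bit x j ≡ 1 × bit y j ≡ 1 ×
    (∀ {k} → k < i → j < k → bit x k + bit y k ≡ 1)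

carry? : ∀ m x y i → Dec (Carry m x y i)
carry? m x y i = anyUpTo?
  (λ j → i ∸ m ≤? j ×-dec bit x j ≟ 1 ×-dec bit y j ≟ 1 ×-dec
    allUpTo? (λ k → j <? k →-dec bit x k + bit y k ≟ 1) i)
  i

carryBit : (m x y i : ℕ) → ℕ
carryBit m x y i = if does (carry? m x y i) then 1 else 0

-- The sum runs over 1 ≤ i ≤ N − 1; the index of applyUpTo is i − 1.

carries : (N m x y : ℕ) → ℕ
carries N m x y =
  sum (applyUpTo (λ i-1 → carryBit m x y (suc i-1) * 2 ^ suc i-1) (N ∸ 1))

truncatedAdd : (N m x y : ℕ) → ℕ
truncatedAdd N m x y = xor N (xor N x y) (carries N m x y)

integers : ∀ N → List (Fin (2 ^ N))
integers N = allFin (2 ^ N)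

integers-nonEmpty : ∀ N → NonZero (length (integers N))
integers-nonEmpty N =
  subst NonZero (sym (length-tabulate {n = 2 ^ N} id)) (m^n≢0 2 N)

π : (m N : ℕ) → ℚ
π m N = Pr (integers N) {{integers-nonEmpty N}}
  (λ x y → truncatedAdd N m (toℕ x) (toℕ y) ≟ add N (toℕ x) (toℕ y))

-- Strings are written from left to right: the head of a string of length j is
-- the digit at position j − 1.

strings : ∀ j → List (Vec Bit j)
strings zero    = [ [] ]
strings (suc j) = cartesianProductWith _∷_ (allFin 2) (strings j)

strings-complete : ∀ {j} (u : Vec Bit j) → u ∈ strings j
strings-complete []      = here refl
strings-complete (b ∷ u) =
  ∈-cartesianProductWith⁺ _∷_ (∈-allFin b) (strings-complete u)

strings-unique : ∀ j → Unique (strings j)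
strings-unique zero    = [] ∷ []
strings-unique (suc j) =
  cartesianProductWith⁺ _∷_ ∷-injective (allFin⁺ 2) (strings-unique j)

strings-nonEmpty : ∀ j → NonZero (length (strings j))
strings-nonEmpty j with strings j | strings-complete (Vec.replicate j 0b)
... | _ ∷ _ | _ = _

-- Ternary strings have natural numbers as digits; here all of them are ≤ 2.

digitSums : ∀ {j} → Vec Bit j → Vec Bit j → List ℕ
digitSums u v = toList (zipWith (λ b c → toℕ b + toℕ c) u v)

P : ℕ → List ℕ
P m = replicate m 1 ++ [ 2 ]

Avoids : ∀ m {j} → Rel (Vec Bit j) _
Avoids m u v = ¬ Infix _≡_ (P m) (digitSums u v)

avoids? : ∀ m {j} → Decidable (Avoids m {j})
avoids? m u v = ¬? (infix? _≟_ (P m) (digitSums u v))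

a : (m j : ℕ) → ℚ
a m j = Pr (strings j) {{strings-nonEmpty j}} (avoids? m)

{-# OPTIONS --safe #-}

-- Adding the digit sums dᵢ = xᵢ + yᵢ ∈ {0, 1, 2} from the right, a carry enters
-- position i exactly when the digits to the right of i read 1ˡ2⋯ for some l, and
-- the truncated carry keeps it exactly when l < m.  All sum bits determine all
-- carries, so the two additions agree iff no run of some length l ≥ m occurs below
-- a position i ≤ N − 1, that is, iff d_{N−2} ⋯ d₀ avoids 1ᵐ2.  The top digits of x
-- and y are irrelevant: they multiply both the favourable and all pairs by 4.

module Submission where

open import Data.Bool.Base using (true; false)
open import Data.Digit using (Bit; 0b; 1b)
open import Data.Fin.Base using (toℕ)
open import Data.Fin.Properties using (toℕ<n)
import Data.Integer.Base as ℤ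
import Data.Integer.Properties as ℤ
open import Data.List.Base
  using (List; []; _∷_; _++_; [_]; length; filter; map; applyUpTo; applyDownFrom;
         upTo; tabulate; cartesianProduct)
open import Data.List.Properties
  using (applyUpTo-∷ʳ; map-++; map-∘; map-id; map-cong; map-tabulate; length-map; length-++;
         ++-identityʳ; filter-++; filter-≐; map-upTo)
open import Data.List.Relation.Binary.Infix.Heterogeneous using (Infix; here; there)
open import Data.List.Relation.Binary.Prefix.Heterogeneous using (Prefix; []; _∷_)
open import Data.Nat.Base
  using (ℕ; zero; suc; _+_; _*_; _∸_; _^_; _≤_; _<_; s≤s; z<s; s<s; s≤s⁻¹; NonZero)
open import Data.Nat.DivMod
  using (_/_; _%_; m≡m%n+[m/n]*n; m%n<n; m<n⇒m%n≡m; [m+kn]%n≡m%n; %-distribˡ-+;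
         +-distrib-/-∣ʳ; m*n/n≡m; m<n⇒m/n≡0; %-congˡ)
open import Data.Nat.Divisibility using (n∣m*n)
open import Data.Nat.ListAction using (sum)
open import Data.Nat.ListAction.Properties using (sum-++)
open import Data.Nat.Properties
open import Algebra.Properties.CommutativeSemigroup +-commutativeSemigroup
  using () renaming (interchange to +-interchange)
open import Data.Nat.Tactic.RingSolver using (solve-∀)
open import Data.Product.Base using (∃; _×_; _,_; proj₁; proj₂)
import Data.Product.Base as Product
import Data.Rational.Base as ℚ
open import Data.Rational.Properties using (fromℚᵘ-cong)
open import Data.Rational.Unnormalised.Base using (mkℚᵘ; *≡*)
open import Data.Sum.Base using (_⊎_; inj₁; inj₂)
open import Data.Vec.Base using (Vec; []; _∷_; tail)
open import Function.Base using (id; _∘_)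
open import Function.Bundles using (_⇔_; mk⇔; Equivalence)
open import Level using (Level)
open import Relation.Binary.Core using (REL)
open import Relation.Binary.Definitions using (Decidable)
open import Relation.Binary.PropositionalEquality hiding ([_])
open import Relation.Nullary.Decidable using (yes; no; does)
open import Relation.Nullary.Negation using (¬_; contradiction)
import Relation.Unary as U

open import Defs

private
  variable
    ℓ ℓ′ ρ ρ′ : Level
    A B C D : Set ℓ
    b c d : ℕ → ℕ
    i k l m n x y : ℕ

-- Binary expansions

bit<2 : ∀ x i → bit x i < 2
bit<2 x i = m%n<n (_/_ x (2 ^ i) {{m^n≢0 2 i}}) 2

r+b*2^n<2^[1+n] : ∀ n → x < 2 ^ n → k < 2 → x + k * 2 ^ n < 2 ^ suc n
r+b*2^n<2^[1+n] n x<2^n k<2 = +-mono-<-≤ x<2^n (*-monoˡ-≤ (2 ^ n) (s≤s⁻¹ k<2))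

[r+q*n]/n≡q : ∀ {r} q n .{{_ : NonZero n}} → r < n → (r + q * n) / n ≡ q
[r+q*n]/n≡q {r} q n r<n = begin
  (r + q * n) / n      ≡⟨ +-distrib-/-∣ʳ r (n∣m*n q) ⟩
  r / n + q * n / n    ≡⟨ cong₂ _+_ (m<n⇒m/n≡0 r<n) (m*n/n≡m q n) ⟩
  q                    ∎
  where open ≡-Reasoning

bit-r+q*2^n : ∀ n q → x < 2 ^ n → bit (x + q * 2 ^ n) n ≡ q % 2
bit-r+q*2^n n q x<2^n = %-congˡ ([r+q*n]/n≡q q (2 ^ n) {{m^n≢0 2 n}} x<2^n)

[b+q*2]%2≡b : ∀ q → k < 2 → (k + q * 2) % 2 ≡ k
[b+q*2]%2≡b {k} q k<2 = trans ([m+kn]%n≡m%n k q 2) (m<n⇒m%n≡m k<2)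

-- Written so that `xor` is an instance by definition, and `carries` one too once its missing term
-- at 0 is restored.
fromBits : (ℕ → ℕ) → ℕ → ℕ
fromBits b n = sum (applyUpTo (λ i → b i * 2 ^ i) n)

fromBits-suc : ∀ b n → fromBits b (suc n) ≡ fromBits b n + b n * 2 ^ n
fromBits-suc b n = begin
  sum (applyUpTo f (suc n))        ≡⟨ cong sum (applyUpTo-∷ʳ f n) ⟨
  sum (applyUpTo f n ++ [ f n ])   ≡⟨ sum-++ (applyUpTo f n) [ f n ] ⟩
  fromBits b n + (f n + 0)         ≡⟨ cong (fromBits b n +_) (+-identityʳ (f n)) ⟩
  fromBits b n + f n               ∎
  where
  open ≡-Reasoning
  f = λ i → b i * 2 ^ i

fromBits-cong : ∀ n → (∀ {i} → i < n → b i ≡ c i) → fromBits b n ≡ fromBits c n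
fromBits-cong zero    b≡c = refl
fromBits-cong {b} {c} (suc n) b≡c = begin
  fromBits b (suc n)          ≡⟨ fromBits-suc b n ⟩
  fromBits b n + b n * 2 ^ n  ≡⟨ cong₂ (λ s t → s + t * 2 ^ n)
                                   (fromBits-cong n (b≡c ∘ m<n⇒m<1+n)) (b≡c ≤-refl) ⟩
  fromBits c n + c n * 2 ^ n  ≡⟨ fromBits-suc c n ⟨
  fromBits c (suc n)          ∎
  where open ≡-Reasoning

fromBits<2^n : (∀ i → b i < 2) → ∀ n → fromBits b n < 2 ^ n
fromBits<2^n b<2 zero    = z<s
fromBits<2^n {b} b<2 (suc n) = subst (_< 2 ^ suc n) (sym (fromBits-suc b n))
  (r+b*2^n<2^[1+n] n (fromBits<2^n b<2 n) (b<2 n))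

-- Isolates digit k: every higher term is a multiple of 2 * 2 ^ k and goes into the even part
-- `q * 2`, so the quotient by 2 ^ k has the parity of `b k`.
fromBits-split : ∀ b → k < n → ∃ λ q → fromBits b n ≡ fromBits b k + (b k + q * 2) * 2 ^ k
fromBits-split {k} {suc n} b k<1+n with m≤n⇒m<n∨m≡n (s≤s⁻¹ k<1+n)
... | inj₂ refl = 0 , trans (fromBits-suc b k)
                        (cong (λ t → fromBits b k + t * 2 ^ k) (sym (+-identityʳ (b k))))
... | inj₁ k<n with fromBits-split b k<n
-- Since n = suc k + e, the new term b n * 2 ^ n contributes b n * 2 ^ e further copies of 2 * 2 ^
-- k.
...   | q , eq = q + b n * 2 ^ e , (begin
  fromBits b (suc n)                                                ≡⟨ fromBits-suc b n ⟩
  fromBits b n + b n * 2 ^ n                                        ≡⟨ cong₂ (λ s t → s + b n * t) eq 2^n≡ ⟩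
  fromBits b k + (b k + q * 2) * 2 ^ k + b n * (2 * 2 ^ k * 2 ^ e)
    ≡⟨ regroup (fromBits b k) (b k) q (2 ^ k) (b n) (2 ^ e) ⟩
  fromBits b k + (b k + (q + b n * 2 ^ e) * 2) * 2 ^ k              ∎)
  where
  open ≡-Reasoning
  e = n ∸ suc k
  2^n≡ : 2 ^ n ≡ 2 * 2 ^ k * 2 ^ e
  2^n≡ = trans (cong (2 ^_) (sym (m+[n∸m]≡n k<n))) (^-distribˡ-+-* 2 (suc k) e)
  regroup : ∀ f bk q K bn E →
            f + (bk + q * 2) * K + bn * (2 * K * E) ≡ f + (bk + (q + bn * E) * 2) * K
  regroup = solve-∀

bit-fromBits : (∀ i → b i < 2) → k < n → bit (fromBits b n) k ≡ b k
bit-fromBits {b} {k} {n} b<2 k<n with fromBits-split b k<n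
... | q , eq = begin
  bit (fromBits b n) k                                ≡⟨ cong (λ t → bit t k) eq ⟩
  bit (fromBits b k + (b k + q * 2) * 2 ^ k) k        ≡⟨ bit-r+q*2^n k (b k + q * 2) (fromBits<2^n b<2 k) ⟩
  (b k + q * 2) % 2                                   ≡⟨ [b+q*2]%2≡b q (b<2 k) ⟩
  b k                                                 ∎
  where open ≡-Reasoning

fromBits-injective : (∀ i → b i < 2) → (∀ i → c i < 2) →
                     fromBits b n ≡ fromBits c n → i < n → b i ≡ c i
fromBits-injective {i = i} b<2 c<2 eq i<n =
  trans (sym (bit-fromBits b<2 i<n)) (trans (cong (λ t → bit t i) eq) (bit-fromBits c<2 i<n))

-- Repeated halving: `q` is what is left of `x` after n digits; its parity is `bit x n`, and `q / 2`
-- is the next witness.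
fromBits-bit-split : ∀ x n → ∃ λ q → x ≡ fromBits (bit x) n + q * 2 ^ n
fromBits-bit-split x zero    = x , sym (*-identityʳ x)
fromBits-bit-split x (suc n) with fromBits-bit-split x n
... | q , eq = q / 2 , (begin
  x                                                             ≡⟨ eq ⟩
  F + q * 2 ^ n                                                 ≡⟨ cong (λ t → F + t * 2 ^ n) q≡ ⟩
  F + (bit x n + q / 2 * 2) * 2 ^ n                             ≡⟨ regroup F (bit x n) (q / 2) (2 ^ n) ⟩
  F + bit x n * 2 ^ n + q / 2 * 2 ^ suc n                       ≡⟨ cong (_+ q / 2 * 2 ^ suc n) (fromBits-suc (bit x) n) ⟨
  fromBits (bit x) (suc n) + q / 2 * 2 ^ suc n                  ∎)
  where
  open ≡-Reasoning
  F = fromBits (bit x) n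
  bit≡ : bit x n ≡ q % 2
  bit≡ = trans (cong (λ t → bit t n) eq) (bit-r+q*2^n n q (fromBits<2^n (bit<2 x) n))
  q≡ : q ≡ bit x n + q / 2 * 2
  q≡ = trans (m≡m%n+[m/n]*n q 2) (cong (_+ q / 2 * 2) (sym bit≡))
  regroup : ∀ f b q K → f + (b + q * 2) * K ≡ f + b * K + q * (2 * K)
  regroup = solve-∀

infixl 7 _%2^_
_%2^_ : ℕ → ℕ → ℕ
x %2^ n = _%_ x (2 ^ n) {{m^n≢0 2 n}}

[r+q*2^n]%2^n≡r : ∀ n q → x < 2 ^ n → (x + q * 2 ^ n) %2^ n ≡ x
[r+q*2^n]%2^n≡r {x} n q x<2^n =
  trans ([m+kn]%n≡m%n x q (2 ^ n) {{m^n≢0 2 n}}) (m<n⇒m%n≡m {{m^n≢0 2 n}} x<2^n)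

%2^n≡fromBits : ∀ x n → x %2^ n ≡ fromBits (bit x) n
%2^n≡fromBits x n = let q , eq = fromBits-bit-split x n in
  trans (cong (_%2^ n) eq) ([r+q*2^n]%2^n≡r n q (fromBits<2^n (bit<2 x) n))

-- Carries

-- The ripple carry of ordinary addition. It is a function of the digit sums alone, so carries can
-- be read off a ternary string.
carryInto : (ℕ → ℕ) → ℕ → ℕ
carryInto d zero    = 0
carryInto d (suc i) = (d i + carryInto d i) / 2

bitSum : ℕ → ℕ → ℕ → ℕ
bitSum x y i = bit x i + bit y i

bitSum≤2 : ∀ x y i → bitSum x y i ≤ 2
bitSum≤2 x y i = +-mono-≤ (s≤s⁻¹ (bit<2 x i)) (s≤s⁻¹ (bit<2 y i))

-- Schoolbook addition: each step splits digit sum plus incoming carry into remainder and quotient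
-- by 2, and the quotient is the outgoing carry.
fromBits-+ : ∀ b c n → let d = λ i → b i + c i in
  fromBits b n + fromBits c n ≡
  fromBits (λ i → (d i + carryInto d i) % 2) n + carryInto d n * 2 ^ n
fromBits-+ b c zero    = refl
fromBits-+ b c (suc n) = begin
  fromBits b (suc n) + fromBits c (suc n)
    ≡⟨ cong₂ _+_ (fromBits-suc b n) (fromBits-suc c n) ⟩
  (fromBits b n + b n * K) + (fromBits c n + c n * K)
    ≡⟨ regroup (fromBits b n) (b n) (fromBits c n) (c n) K ⟩
  (fromBits b n + fromBits c n) + δ n * K
    ≡⟨ cong (_+ δ n * K) (fromBits-+ b c n) ⟩
  (fromBits s n + γ * K) + δ n * K
    ≡⟨ regroup′ (fromBits s n) γ (δ n) K ⟩
  fromBits s n + (δ n + γ) * K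
    ≡⟨ cong (λ t → fromBits s n + t * K) (m≡m%n+[m/n]*n (δ n + γ) 2) ⟩
  fromBits s n + (s n + carryInto δ (suc n) * 2) * K
    ≡⟨ regroup″ (fromBits s n) (s n) (carryInto δ (suc n)) K ⟩
  (fromBits s n + s n * K) + carryInto δ (suc n) * (2 * K)
    ≡⟨ cong (_+ carryInto δ (suc n) * (2 * K)) (fromBits-suc s n) ⟨
  fromBits s (suc n) + carryInto δ (suc n) * 2 ^ suc n
    ∎
  where
  open ≡-Reasoning
  K = 2 ^ n
  δ = λ i → b i + c i
  γ = carryInto δ n
  s = λ i → (δ i + carryInto δ i) % 2
  regroup : ∀ f b g c K → (f + b * K) + (g + c * K) ≡ (f + g) + (b + c) * K
  regroup = solve-∀
  regroup′ : ∀ f γ d K → (f + γ * K) + d * K ≡ f + (d + γ) * K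
  regroup′ = solve-∀
  regroup″ : ∀ f s γ K → f + (s + γ * 2) * K ≡ (f + s * K) + γ * (2 * K)
  regroup″ = solve-∀

add≡fromBits : ∀ N x y → add N x y ≡
  fromBits (λ i → (bitSum x y i + carryInto (bitSum x y) i) % 2) N
add≡fromBits N x y = begin
  (x + y) %2^ N                                     ≡⟨ %-distribˡ-+ x y (2 ^ N) {{m^n≢0 2 N}} ⟩
  (x %2^ N + y %2^ N) %2^ N                         ≡⟨ cong₂ (λ p q → (p + q) %2^ N) (%2^n≡fromBits x N) (%2^n≡fromBits y N) ⟩
  (fromBits (bit x) N + fromBits (bit y) N) %2^ N   ≡⟨ cong (_%2^ N) (fromBits-+ (bit x) (bit y) N) ⟩
  -- The carry out of the top position is weighted by 2 ^ N and vanishes modulo 2 ^ N.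
  (fromBits s N + γ * 2 ^ N) %2^ N                  ≡⟨ [r+q*2^n]%2^n≡r N γ (fromBits<2^n (λ i → m%n<n (t i) 2) N) ⟩
  fromBits s N                                      ∎
  where
  open ≡-Reasoning
  t = λ i → bitSum x y i + carryInto (bitSum x y) i
  s = λ i → t i % 2
  γ = carryInto (bitSum x y) N

carryBit<2 : ∀ m x y i → carryBit m x y i < 2
carryBit<2 m x y i with carry? m x y i
... | yes _ = s<s z<s
... | no  _ = z<s

Carry⇔carryBit≡1 : ∀ m x y i → Carry m x y i ⇔ carryBit m x y i ≡ 1
Carry⇔carryBit≡1 m x y i with carry? m x y i
... | yes p = mk⇔ (λ _ → refl) (λ _ → p)
... | no ¬p = mk⇔ (λ p → contradiction p ¬p) (λ ())

truncatedAdd≡fromBits : ∀ n m x y → truncatedAdd (suc n) m x y ≡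
  fromBits (λ i → (bitSum x y i + carryBit m x y i) % 2) (suc n)
truncatedAdd≡fromBits n m x y = fromBits-cong (suc n) λ {i} i<N → begin
  -- `carryBit` at 0 computes to 0, so `fromBits q (suc n)` unfolds to `carries`, whose sum begins
  -- at position 1.
  (bit (fromBits p (suc n)) i + bit (fromBits q (suc n)) i) % 2
                                               ≡⟨ cong₂ (λ s t → (s + t) % 2) (bit-fromBits p<2 i<N) (bit-fromBits q<2 i<N) ⟩
  (p i + q i) % 2                              ≡⟨ cong (λ t → (p i + t) % 2) (m<n⇒m%n≡m (q<2 i)) ⟨
  (p i + q i % 2) % 2                          ≡⟨ %-distribˡ-+ (bitSum x y i) (q i) 2 ⟨
  (bitSum x y i + q i) % 2                     ∎
  where
  open ≡-Reasoning
  p = λ i → bitSum x y i % 2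
  q = carryBit m x y
  p<2 = λ i → m%n<n (bitSum x y i) 2
  q<2 = carryBit<2 m x y

-- Adding `d` is an involution modulo 2. This turns equal sum digits into equal carries.
+-cancelˡ-%2 : ∀ d → k < 2 → l < 2 → (d + k) % 2 ≡ (d + l) % 2 → k ≡ l
+-cancelˡ-%2 {k} {l} d k<2 l<2 eq = begin
  k                        ≡⟨ twice k k<2 ⟨
  (d + (d + k) % 2) % 2    ≡⟨ cong (λ t → (d + t) % 2) eq ⟩
  (d + (d + l) % 2) % 2    ≡⟨ twice l l<2 ⟩
  l                        ∎
  where
  open ≡-Reasoning
  regroup : ∀ d k → d + (d + k) ≡ k + d * 2
  regroup = solve-∀
  twice : ∀ k → k < 2 → (d + (d + k) % 2) % 2 ≡ k
  twice k k<2 = begin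
    (d + (d + k) % 2) % 2               ≡⟨ %-distribˡ-+ d ((d + k) % 2) 2 ⟩
    (d % 2 + (d + k) % 2 % 2) % 2       ≡⟨ cong (λ t → (d % 2 + t) % 2) (m<n⇒m%n≡m (m%n<n (d + k) 2)) ⟩
    (d % 2 + (d + k) % 2) % 2           ≡⟨ %-distribˡ-+ d (d + k) 2 ⟨
    (d + (d + k)) % 2                   ≡⟨ %-congˡ (regroup d k) ⟩
    (k + d * 2) % 2                     ≡⟨ [b+q*2]%2≡b d k<2 ⟩
    k                                   ∎

-- Run d l i: the digits of d to the right of position i begin with l ones
-- followed by a 2.

data Run (d : ℕ → ℕ) : ℕ → ℕ → Set where
  start  : d i ≡ 2 → Run d 0 (suc i)
  extend : d i ≡ 1 → Run d l i → Run d (suc l) (suc i)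

-- At each position the digit decides the constructor: 2 stops the run, 1 continues it.
run-unique : Run d k i → Run d l i → k ≡ l
run-unique (start _)    (start _)    = refl
run-unique (start p)    (extend q _) = contradiction (trans (sym p) q) λ ()
run-unique (extend p _) (start q)    = contradiction (trans (sym p) q) λ ()
run-unique (extend _ r) (extend _ s) = cong suc (run-unique r s)

-- Dropping leading ones moves the position to the right, so a run that is too long contains one of
-- length exactly `m`, the form that `P m` matches.
run-shorten : m ≤ l → Run d l i → ∃ λ k → k ≤ i × Run d m k
run-shorten {i = i} m≤l r with m≤n⇒m<n∨m≡n m≤l
... | inj₂ refl = i , ≤-refl , r
run-shorten m≤l (extend _ r) | inj₁ m<l =
  Product.map₂ (Product.map₁ m≤n⇒m≤1+n) (run-shorten (s≤s⁻¹ m<l) r)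

-- A digit 0 absorbs any incoming carry, 1 passes it on and 2 creates one regardless; so a carry can
-- be traced back through ones to a 2.
carryInto-cases : (∀ i → d i ≤ 2) → ∀ i →
                  carryInto d i ≡ 0 ⊎ (carryInto d i ≡ 1 × ∃ λ l → Run d l i)
carryInto-cases d≤2 zero = inj₁ refl
carryInto-cases {d} d≤2 (suc i)
  with d i in eq | d≤2 i | carryInto d i | carryInto-cases d≤2 i
... | 0 | _ | _ | inj₁ refl                = inj₁ refl
... | 0 | _ | _ | inj₂ (refl , _)          = inj₁ refl
... | 1 | _ | _ | inj₁ refl                = inj₁ refl
... | 1 | _ | _ | inj₂ (refl , l , r)      = inj₂ (refl , suc l , extend eq r)
... | 2 | _ | _ | inj₁ refl                = inj₂ (refl , 0 , start eq)
... | 2 | _ | _ | inj₂ (refl , _)          = inj₂ (refl , 0 , start eq)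
... | suc (suc (suc _)) | s≤s (s≤s ()) | _ | _

carryInto<2 : (∀ i → d i ≤ 2) → ∀ i → carryInto d i < 2
carryInto<2 {d} d≤2 i with carryInto d i | carryInto-cases d≤2 i
... | _ | inj₁ refl       = z<s
... | _ | inj₂ (refl , _) = s<s z<s

-- Converse of `carryInto-cases`: 2 and 3 both have quotient 1 by 2, so a digit 2 carries whatever
-- enters it, and the ones above propagate the carry.
run⇒carryInto≡1 : (∀ i → d i ≤ 2) → Run d l i → carryInto d i ≡ 1
run⇒carryInto≡1 {d} d≤2 (start {i} p) with carryInto d i | carryInto-cases d≤2 i
... | _ | inj₁ refl       = cong (λ t → (t + 0) / 2) p
... | _ | inj₂ (refl , _) = cong (λ t → (t + 1) / 2) p
run⇒carryInto≡1 d≤2 (extend p r) = cong₂ (λ s t → (s + t) / 2) p (run⇒carryInto≡1 d≤2 r)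

-- Runs and truncated carries

bitSum≡2⇔ : ∀ x y i → bitSum x y i ≡ 2 ⇔ (bit x i ≡ 1 × bit y i ≡ 1)
bitSum≡2⇔ x y i with bit x i | bit y i | bit<2 x i | bit<2 y i
... | 0 | 0 | _ | _ = mk⇔ (λ ()) (λ ())
... | 0 | 1 | _ | _ = mk⇔ (λ ()) (λ ())
... | 1 | 0 | _ | _ = mk⇔ (λ ()) (λ ())
... | 1 | 1 | _ | _ = mk⇔ (λ _ → refl , refl) (λ _ → refl)
... | suc (suc _) | _ | s≤s (s≤s ()) | _
... | _ | suc (suc _) | _ | s≤s (s≤s ())

-- The quantified form of `Run`, with the position `j` of the 2 made explicit; it matches the shape
-- of `Carry`.
RunAt : (ℕ → ℕ) → ℕ → ℕ → ℕ → Set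
RunAt d l i j = i ≡ suc (l + j) × d j ≡ 2 × (∀ {k} → k < i → j < k → d k ≡ 1)

run⇒RunAt : Run d l i → ∃ λ j → RunAt d l i j
run⇒RunAt (start {j} p) = j , refl , p , λ k≤j j<k → contradiction (s≤s⁻¹ k≤j) (<⇒≱ j<k)
run⇒RunAt {d} (extend {i} p r) with run⇒RunAt r
... | j , i≡ , dj≡2 , ones = j , cong suc i≡ , dj≡2 , ones′
  where
  ones′ : ∀ {k} → k < suc i → j < k → d k ≡ 1
  ones′ k<1+i j<k with m≤n⇒m<n∨m≡n (s≤s⁻¹ k<1+i)
  ... | inj₁ k<i  = ones k<i j<k
  ... | inj₂ refl = p

RunAt⇒run : ∀ l {j} → RunAt d l i j → Run d l i
RunAt⇒run zero    (refl , dj≡2 , _)    = start dj≡2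
RunAt⇒run (suc l) {j} (refl , dj≡2 , ones) =
  extend (ones ≤-refl (s≤s (m≤n+m j l)))
         (RunAt⇒run l (refl , dj≡2 , λ k<i → ones (m<n⇒m<1+n k<i)))

-- The 2 of the run is the witness. Since i = suc (l + j), the bound l < m yields i ≤ m + j.
run⇒Carry : ∀ m x y i → l < m → Run (bitSum x y) l i → Carry m x y i
run⇒Carry {l} m x y i l<m r with run⇒RunAt r
... | j , refl , dj≡2 , ones with Equivalence.to (bitSum≡2⇔ x y j) dj≡2
...   | xj≡1 , yj≡1 =
  j , s≤s (m≤n+m j l) , m≤n+o⇒m∸n≤o (suc l + j) m (+-monoˡ-≤ j l<m) , xj≡1 , yj≡1 , ones

Carry⇒run : ∀ m x y i → Carry m x y i → ∃ λ l → l < m × Run (bitSum x y) l i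
Carry⇒run m x y i (j , j<i , i∸m≤j , xj≡1 , yj≡1 , ones) =
  len , len<m , RunAt⇒run len (i≡ , dj≡2 , ones)
  where
  -- The number of positions strictly between j and i, all of which have digit sum 1.
  len = i ∸ suc j
  i≡ : i ≡ suc (len + j)
  i≡ = trans (sym (m∸n+n≡m j<i)) (+-suc len j)
  dj≡2 : bitSum x y j ≡ 2
  dj≡2 = Equivalence.from (bitSum≡2⇔ x y j) (xj≡1 , yj≡1)
  len<m : len < m
  -- The bound i ≤ m + (i ∸ m) also holds when i < m, so the truncated subtraction does no harm.
  len<m = +-cancelʳ-≤ j (suc len) m
    (subst (_≤ m + j) i≡ (≤-trans (m≤n+m∸n i m) (+-monoʳ-≤ m i∸m≤j)))

-- Runs as substrings

-- `applyDownFrom d i` begins with the digit just right of position i, so `start` and `extend` match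
-- the digits of `P m` from left to right.
run⇔prefix : ∀ m i → Run d m i ⇔ Prefix _≡_ (P m) (applyDownFrom d i)
run⇔prefix m i = mk⇔ to (from m i)
  where
  to : ∀ {m i} → Run d m i → Prefix _≡_ (P m) (applyDownFrom d i)
  to (start p)    = sym p ∷ []
  to (extend p r) = sym p ∷ to r
  from : ∀ m i → Prefix _≡_ (P m) (applyDownFrom d i) → Run d m i
  from zero    (suc i) (p ∷ _) = start (sym p)
  from (suc m) (suc i) (p ∷ r) = extend (sym p) (from m i r)

-- An infix is a prefix of a suffix, and the suffixes of `applyDownFrom d n` are the lists
-- `applyDownFrom d i` with i ≤ n.
infix⇒run : ∀ n → Infix _≡_ (P m) (applyDownFrom d n) → ∃ λ i → i ≤ n × Run d m i
infix⇒run {m} zero    (here p)  = 0 , ≤-refl , Equivalence.from (run⇔prefix m 0) p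
infix⇒run {m} (suc n) (here p)  = suc n , ≤-refl , Equivalence.from (run⇔prefix m (suc n)) p
infix⇒run     (suc n) (there p) = Product.map₂ (Product.map₁ m≤n⇒m≤1+n) (infix⇒run n p)

run⇒infix : i ≤ n → Run d m i → Infix _≡_ (P m) (applyDownFrom d n)
run⇒infix {i} {n} {m = m} i≤n r with m≤n⇒m<n∨m≡n i≤n
run⇒infix {m = m} i≤n r | inj₂ refl = here (Equivalence.to (run⇔prefix m _) r)
run⇒infix {n = suc n} i≤n r | inj₁ i<1+n = there (run⇒infix (s≤s⁻¹ i<1+n) r)

-- Width suc n goes with n digits: a carry into a position i ≤ n sees only digits below n, and the
-- top digit sum feeds no carry but the discarded one.
truncatedAdd≡add⇔avoids : ∀ n m x y →
  truncatedAdd (suc n) m x y ≡ add (suc n) x y ⇔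
  (¬ Infix _≡_ (P m) (applyDownFrom (bitSum x y) n))
truncatedAdd≡add⇔avoids n m x y = mk⇔ to from
  where
  δ = bitSum x y
  δ≤2 = bitSum≤2 x y

  sumBit<2 : (e : ℕ → ℕ) → ∀ i → (δ i + e i) % 2 < 2
  sumBit<2 e i = m%n<n (δ i + e i) 2

  to : truncatedAdd (suc n) m x y ≡ add (suc n) x y →
       ¬ Infix _≡_ (P m) (applyDownFrom δ n)
  to eq inf with infix⇒run n inf
  -- The ordinary carry into i is 1, so the truncated one is too and comes from a run shorter than
  -- m; but all runs at i have the same length.
  ... | i , i≤n , r = <-irrefl (run-unique r′ r) l<m
    where
    carryBit≡carryInto : carryBit m x y i ≡ carryInto δ i
    carryBit≡carryInto = +-cancelˡ-%2 (δ i) (carryBit<2 m x y i) (carryInto<2 δ≤2 i)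
      (fromBits-injective (sumBit<2 (carryBit m x y)) (sumBit<2 (carryInto δ))
        (trans (sym (truncatedAdd≡fromBits n m x y)) (trans eq (add≡fromBits (suc n) x y)))
        (s≤s i≤n))
    kept : ∃ λ l → l < m × Run δ l i
    kept = Carry⇒run m x y i (Equivalence.from (Carry⇔carryBit≡1 m x y i)
             (trans carryBit≡carryInto (run⇒carryInto≡1 δ≤2 r)))
    l<m = proj₁ (proj₂ kept)
    r′  = proj₂ (proj₂ kept)

  from : ¬ Infix _≡_ (P m) (applyDownFrom δ n) →
         truncatedAdd (suc n) m x y ≡ add (suc n) x y
  from avoids = begin
    truncatedAdd (suc n) m x y                             ≡⟨ truncatedAdd≡fromBits n m x y ⟩
    fromBits (λ i → (δ i + carryBit m x y i) % 2) (suc n)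
      ≡⟨ fromBits-cong (suc n) (λ {i} i<N →
           cong (λ t → (δ i + t) % 2) (carryBit≡carryInto i (s≤s⁻¹ i<N))) ⟩
    fromBits (λ i → (δ i + carryInto δ i) % 2) (suc n)     ≡⟨ add≡fromBits (suc n) x y ⟨
    add (suc n) x y                                        ∎
    where
    open ≡-Reasoning
    -- Otherwise dropping leading ones would expose an occurrence of `P m`.
    short : i ≤ n → Run δ l i → l < m
    short i≤n r = ≰⇒> λ m≤l →
      let k , k≤i , r′ = run-shorten m≤l r in avoids (run⇒infix (≤-trans k≤i i≤n) r′)
    carryBit≡carryInto : ∀ i → i ≤ n → carryBit m x y i ≡ carryInto δ i
    carryBit≡carryInto i i≤n with carryInto-cases δ≤2 i
    ... | inj₂ (γ≡1 , l , r) =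
      trans (Equivalence.to (Carry⇔carryBit≡1 m x y i) (run⇒Carry m x y i (short i≤n r) r)) (sym γ≡1)
    -- Truncation never creates a carry: a truncated carry rests on a run, which would force the
    -- ordinary carry to be 1.
    ... | inj₁ γ≡0 = trans (n<1⇒n≡0 (≤∧≢⇒< (s≤s⁻¹ (carryBit<2 m x y i)) c≢1)) (sym γ≡0)
      where
      c≢1 : carryBit m x y i ≢ 1
      c≢1 c≡1 = contradiction
        (trans (sym γ≡0) (run⇒carryInto≡1 δ≤2
          (proj₂ (proj₂ (Carry⇒run m x y i (Equivalence.from (Carry⇔carryBit≡1 m x y i) c≡1))))))
        λ ()

-- Bit strings as integers

value : Vec Bit n → ℕ
value []                = 0
value {suc n} (b ∷ u)   = value u + toℕ b * 2 ^ n

value<2^n : (u : Vec Bit n) → value u < 2 ^ n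
value<2^n []      = z<s
value<2^n {suc n} (b ∷ u) = r+b*2^n<2^[1+n] n (value<2^n u) (toℕ<n b)

-- Arbitrary higher parts `p` and `q` are allowed because the induction strips the top digit of each
-- string and absorbs it into what lies above the rest.
digitSums≡bitSums : (u v : Vec Bit n) (p q : ℕ) →
  digitSums u v ≡ applyDownFrom (bitSum (value u + p * 2 ^ n) (value v + q * 2 ^ n)) n
digitSums≡bitSums [] [] p q = refl
digitSums≡bitSums {suc n} (b ∷ u) (c ∷ v) p q = trans
  (cong₂ _∷_ (sym (cong₂ _+_ (topBit b u p) (topBit c v q)))
             (digitSums≡bitSums u v (toℕ b + p * 2) (toℕ c + q * 2)))
  (cong₂ (λ x y → applyDownFrom (bitSum x y) (suc n)) (sym (absorb b u p)) (sym (absorb c v q)))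
  where
  regroup : ∀ w b p K → w + b * K + p * (2 * K) ≡ w + (b + p * 2) * K
  regroup = solve-∀
  absorb : ∀ (b : Bit) (u : Vec Bit n) p →
           value (b ∷ u) + p * 2 ^ suc n ≡ value u + (toℕ b + p * 2) * 2 ^ n
  absorb b u p = regroup (value u) (toℕ b) p (2 ^ n)
  topBit : ∀ (b : Bit) (u : Vec Bit n) p → bit (value u + (toℕ b + p * 2) * 2 ^ n) n ≡ toℕ b
  topBit b u p = trans (bit-r+q*2^n n (toℕ b + p * 2) (value<2^n u)) ([b+q*2]%2≡b p (toℕ<n b))

truncatedAdd≡add⇔Avoids : ∀ m (u v : Vec Bit (suc n)) →
  truncatedAdd (suc n) m (value u) (value v) ≡ add (suc n) (value u) (value v) ⇔
  Avoids m (tail u) (tail v)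
truncatedAdd≡add⇔Avoids {n} m (b ∷ u) (c ∷ v) =
  subst (λ w → truncatedAdd (suc n) m (value (b ∷ u)) (value (c ∷ v)) ≡
                 add (suc n) (value (b ∷ u)) (value (c ∷ v)) ⇔ (¬ Infix _≡_ (P m) w))
    -- The leading digits enter as the higher parts, so only the tails appear in the digit string.
    (sym (digitSums≡bitSums u v (toℕ b) (toℕ c)))
    (truncatedAdd≡add⇔avoids n m (value (b ∷ u)) (value (c ∷ v)))

applyUpTo-+ : ∀ (f : ℕ → A) m n →
              applyUpTo f (m + n) ≡ applyUpTo f m ++ applyUpTo (f ∘ (m +_)) n
applyUpTo-+ f zero    n = refl
applyUpTo-+ f (suc m) n = cong (f 0 ∷_) (applyUpTo-+ (f ∘ suc) m n)

-- Heads are most significant and 0 precedes 1, so the lexicographic enumeration is in numerical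
-- order; the lists agree entry by entry, not merely up to permutation.
map-value-strings : ∀ n → map value (strings n) ≡ upTo (2 ^ n)
map-value-strings zero    = refl
map-value-strings (suc n) = begin
  map value (map (0b ∷_) S ++ map (1b ∷_) S ++ [])
    ≡⟨ cong (λ us → map value (map (0b ∷_) S ++ us)) (++-identityʳ (map (1b ∷_) S)) ⟩
  map value (map (0b ∷_) S ++ map (1b ∷_) S)
    ≡⟨ map-++ value (map (0b ∷_) S) (map (1b ∷_) S) ⟩
  map value (map (0b ∷_) S) ++ map value (map (1b ∷_) S)
    ≡⟨ cong₂ _++_ (lead 0b) (lead 1b) ⟩
  applyUpTo (_+ 0) K ++ applyUpTo (_+ 1 * K) K
    ≡⟨ cong₂ _++_ (applyUpTo-cong +-identityʳ K)
                   (applyUpTo-cong (λ i → trans (+-comm i (1 * K)) (cong (_+ i) (*-identityˡ K))) K) ⟩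
  upTo K ++ applyUpTo (K +_) K
    ≡⟨ cong (λ k → upTo K ++ applyUpTo (K +_) k) (*-identityˡ K) ⟨
  upTo K ++ applyUpTo (K +_) (1 * K)
    ≡⟨ applyUpTo-+ id K (1 * K) ⟨
  upTo (2 ^ suc n)
    ∎
  where
  open ≡-Reasoning
  K = 2 ^ n
  S = strings n
  applyUpTo-cong : ∀ {f g : ℕ → ℕ} → f ≗ g → applyUpTo f ≗ applyUpTo g
  applyUpTo-cong {f} {g} f≗g k =
    trans (sym (map-upTo f k)) (trans (map-cong f≗g (upTo k)) (map-upTo g k))
  lead : ∀ b → map value (map (b ∷_) S) ≡ applyUpTo (_+ toℕ b * K) K
  lead b = begin
    map value (map (b ∷_) S)             ≡⟨ map-∘ S ⟨
    map (λ u → value u + toℕ b * K) S    ≡⟨ map-∘ S ⟩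
    map (_+ toℕ b * K) (map value S)     ≡⟨ cong (map (_+ toℕ b * K)) (map-value-strings n) ⟩
    map (_+ toℕ b * K) (upTo K)          ≡⟨ map-upTo (_+ toℕ b * K) K ⟩
    applyUpTo (_+ toℕ b * K) K           ∎

tabulate-toℕ : ∀ (f : ℕ → A) n → tabulate {n = n} (f ∘ toℕ) ≡ applyUpTo f n
tabulate-toℕ f zero    = refl
tabulate-toℕ f (suc n) = cong (f 0 ∷_) (tabulate-toℕ (f ∘ suc) n)

map-toℕ-integers : ∀ n → map toℕ (integers n) ≡ map value (strings n)
map-toℕ-integers n = trans (map-tabulate {n = 2 ^ n} id toℕ)
  (trans (tabulate-toℕ id (2 ^ n)) (sym (map-value-strings n)))

-- Forgetting the top digit hits each shorter string twice; for pairs this becomes the factor 4.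
map-tail-strings : ∀ n → map tail (strings (suc n)) ≡ strings n ++ strings n
map-tail-strings n = begin
  map tail (map (0b ∷_) S ++ map (1b ∷_) S ++ [])
    ≡⟨ cong (λ us → map tail (map (0b ∷_) S ++ us)) (++-identityʳ (map (1b ∷_) S)) ⟩
  map tail (map (0b ∷_) S ++ map (1b ∷_) S)
    ≡⟨ map-++ tail (map (0b ∷_) S) (map (1b ∷_) S) ⟩
  map tail (map (0b ∷_) S) ++ map tail (map (1b ∷_) S)
    ≡⟨ cong₂ _++_ (map-tail-∷ 0b) (map-tail-∷ 1b) ⟩
  S ++ S
    ∎
  where
  open ≡-Reasoning
  S = strings n
  map-tail-∷ : ∀ b → map tail (map (b ∷_) S) ≡ S
  map-tail-∷ b = trans (sym (map-∘ S)) (map-id S)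

length-integers : ∀ n → length (integers (suc n)) ≡ length (strings n) + length (strings n)
length-integers n = begin
  length (integers (suc n))              ≡⟨ length-map toℕ (integers (suc n)) ⟨
  length (map toℕ (integers (suc n)))    ≡⟨ cong length (map-toℕ-integers (suc n)) ⟩
  length (map value (strings (suc n)))   ≡⟨ length-map value (strings (suc n)) ⟩
  length (strings (suc n))               ≡⟨ length-map tail (strings (suc n)) ⟨
  length (map tail (strings (suc n)))    ≡⟨ cong length (map-tail-strings n) ⟩
  length (strings n ++ strings n)        ≡⟨ length-++ (strings n) ⟩
  length (strings n) + length (strings n) ∎
  where open ≡-Reasoning

-- Counting pairs

length-filter-map : {Q : U.Pred B ρ} (Q? : U.Decidable Q) (f : A → B) (xs : List A) →
                    length (filter Q? (map f xs)) ≡ length (filter (Q? ∘ f) xs)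
length-filter-map Q? f []       = refl
length-filter-map Q? f (x ∷ xs) with does (Q? (f x))
... | true  = cong suc (length-filter-map Q? f xs)
... | false = length-filter-map Q? f xs

-- The numerator of `Pr`, with separate lists for the two samples so that each can be split on its
-- own.
count : {R : REL A B ρ} → Decidable R → List A → List B → ℕ
count R? xs ys = length (filter (λ (x , y) → R? x y) (cartesianProduct xs ys))

module _ {A : Set ℓ} {B : Set ℓ′} {R : REL A B ρ} (R? : Decidable R) where

  count-∷ : ∀ x xs ys → count R? (x ∷ xs) ys ≡ length (filter (R? x) ys) + count R? xs ys
  count-∷ x xs ys = begin
    length (filter R?′ (map (x ,_) ys ++ cartesianProduct xs ys))
      ≡⟨ cong length (filter-++ R?′ (map (x ,_) ys) (cartesianProduct xs ys)) ⟩
    length (filter R?′ (map (x ,_) ys) ++ filter R?′ (cartesianProduct xs ys))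
      ≡⟨ length-++ (filter R?′ (map (x ,_) ys)) ⟩
    length (filter R?′ (map (x ,_) ys)) + count R? xs ys
      ≡⟨ cong (_+ count R? xs ys) (length-filter-map R?′ (x ,_) ys) ⟩
    length (filter (R? x) ys) + count R? xs ys
      ∎
    where
    open ≡-Reasoning
    R?′ = λ ((x , y) : A × B) → R? x y

  count-++ˡ : ∀ xs xs′ ys → count R? (xs ++ xs′) ys ≡ count R? xs ys + count R? xs′ ys
  count-++ˡ []       xs′ ys = refl
  count-++ˡ (x ∷ xs) xs′ ys = begin
    count R? (x ∷ xs ++ xs′) ys                   ≡⟨ count-∷ x (xs ++ xs′) ys ⟩
    cx + count R? (xs ++ xs′) ys                  ≡⟨ cong (cx +_) (count-++ˡ xs xs′ ys) ⟩
    cx + (count R? xs ys + count R? xs′ ys)       ≡⟨ +-assoc cx (count R? xs ys) (count R? xs′ ys) ⟨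
    (cx + count R? xs ys) + count R? xs′ ys       ≡⟨ cong (_+ count R? xs′ ys) (count-∷ x xs ys) ⟨
    count R? (x ∷ xs) ys + count R? xs′ ys        ∎
    where
    open ≡-Reasoning
    cx = length (filter (R? x) ys)

  count-++ʳ : ∀ xs ys ys′ → count R? xs (ys ++ ys′) ≡ count R? xs ys + count R? xs ys′
  count-++ʳ []       ys ys′ = refl
  count-++ʳ (x ∷ xs) ys ys′ = begin
    count R? (x ∷ xs) (ys ++ ys′)
      ≡⟨ count-∷ x xs (ys ++ ys′) ⟩
    length (filter (R? x) (ys ++ ys′)) + count R? xs (ys ++ ys′)
      ≡⟨ cong₂ _+_ (trans (cong length (filter-++ (R? x) ys ys′)) (length-++ (filter (R? x) ys)))
                   (count-++ʳ xs ys ys′) ⟩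
    (cx ys + cx ys′) + (count R? xs ys + count R? xs ys′)
      ≡⟨ +-interchange (cx ys) (cx ys′) (count R? xs ys) (count R? xs ys′) ⟩
    (cx ys + count R? xs ys) + (cx ys′ + count R? xs ys′)
      ≡⟨ cong₂ _+_ (count-∷ x xs ys) (count-∷ x xs ys′) ⟨
    count R? (x ∷ xs) ys + count R? (x ∷ xs) ys′
      ∎
    where
    open ≡-Reasoning
    cx : List B → ℕ
    cx = length ∘ filter (R? x)

count-map : {R : REL A B ρ} (R? : Decidable R) (f : C → A) (g : D → B) →
            ∀ xs ys → count R? (map f xs) (map g ys) ≡ count (λ x y → R? (f x) (g y)) xs ys
count-map R? f g []       ys = refl
count-map R? f g (x ∷ xs) ys = begin
  count R? (map f (x ∷ xs)) (map g ys)
    ≡⟨ count-∷ R? (f x) (map f xs) (map g ys) ⟩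
  length (filter (R? (f x)) (map g ys)) + count R? (map f xs) (map g ys)
    ≡⟨ cong₂ _+_ (length-filter-map (R? (f x)) g ys) (count-map R? f g xs ys) ⟩
  length (filter (R? (f x) ∘ g) ys) + count (λ x y → R? (f x) (g y)) xs ys
    ≡⟨ count-∷ (λ x y → R? (f x) (g y)) x xs ys ⟨
  count (λ x y → R? (f x) (g y)) (x ∷ xs) ys
    ∎
  where open ≡-Reasoning

count-cong : {R : REL A B ρ} {S : REL A B ρ′} (R? : Decidable R) (S? : Decidable S) →
             (∀ x y → R x y ⇔ S x y) → ∀ xs ys → count R? xs ys ≡ count S? xs ys
count-cong R? S? R⇔S xs ys = cong length
  (filter-≐ _ _ ((λ {(x , y)} → Equivalence.to (R⇔S x y)) , λ {(x , y)} → Equivalence.from (R⇔S x y))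
    (cartesianProduct xs ys))

-- Comparison of the two probabilities

agree? : ∀ N m → Decidable (λ x y → truncatedAdd N m x y ≡ add N x y)
agree? N m x y = truncatedAdd N m x y ≟ add N x y

count-truncatedAdd≡add : ∀ m n →
  count (λ x y → agree? (suc n) m (toℕ x) (toℕ y)) (integers (suc n)) (integers (suc n)) ≡
  4 * count (avoids? m) (strings n) (strings n)
count-truncatedAdd≡add m n = begin
  count (λ x y → agreeₘ? (toℕ x) (toℕ y)) I I        ≡⟨ count-map agreeₘ? toℕ toℕ I I ⟨
  count agreeₘ? (map toℕ I) (map toℕ I)              ≡⟨ cong (λ xs → count agreeₘ? xs xs) (map-toℕ-integers (suc n)) ⟩
  count agreeₘ? (map value T) (map value T)          ≡⟨ count-map agreeₘ? value value T T ⟩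
  count (λ u v → agreeₘ? (value u) (value v)) T T    ≡⟨ count-cong _ _ (truncatedAdd≡add⇔Avoids m) T T ⟩
  -- The relation now depends on the tails only, so both lists can be pushed along `tail`.
  count (λ u v → avoids? m (tail u) (tail v)) T T   ≡⟨ count-map (avoids? m) tail tail T T ⟨
  count (avoids? m) (map tail T) (map tail T)       ≡⟨ cong (λ us → count (avoids? m) us us) (map-tail-strings n) ⟩
  count (avoids? m) (S ++ S) (S ++ S)               ≡⟨ count-++ˡ (avoids? m) S S (S ++ S) ⟩
  count (avoids? m) S (S ++ S) + count (avoids? m) S (S ++ S)
    ≡⟨ cong (λ k → k + k) (count-++ʳ (avoids? m) S S S) ⟩
  (κ + κ) + (κ + κ)                                 ≡⟨ four κ ⟩
  4 * κ                                             ∎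
  where
  open ≡-Reasoning
  I = integers (suc n)
  T = strings (suc n)
  S = strings n
  agreeₘ? = agree? (suc n) m
  κ = count (avoids? m) S S
  four : ∀ c → (c + c) + (c + c) ≡ 4 * c
  four = solve-∀

-- `ℚ._/_` reduces to lowest terms, so the fractions are compared as unnormalised rationals, where
-- equality is cross-multiplication.
/-cross : ∀ k l m n .{{_ : NonZero m}} .{{_ : NonZero n}} →
          k * n ≡ l * m → ℤ.+ k ℚ./ m ≡ ℤ.+ l ℚ./ n
/-cross k l (suc m) (suc n) eq = fromℚᵘ-cong {mkℚᵘ (ℤ.+ k) m} {mkℚᵘ (ℤ.+ l) n}
  (*≡* (trans (sym (ℤ.pos-* k (suc n))) (trans (cong ℤ.+_ eq) (ℤ.pos-* l (suc m)))))

corollary2p7 : (N m : ℕ) → 1 ≤ N → π m N ≡ a m (N ∸ 1)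
corollary2p7 (suc n) m _ = /-cross κ′ κ (I * I) (L * L)
  {{m*n≢0 I I {{integers-nonEmpty (suc n)}} {{integers-nonEmpty (suc n)}}}}
  {{m*n≢0 L L {{strings-nonEmpty n}} {{strings-nonEmpty n}}}}
  (begin
    κ′ * (L * L)             ≡⟨ cong (_* (L * L)) (count-truncatedAdd≡add m n) ⟩
    4 * κ * (L * L)          ≡⟨ regroup κ L ⟩
    -- There are twice as many integers as strings, so the number of all pairs also grows by the
    -- factor 4.
    κ * ((L + L) * (L + L))  ≡⟨ cong (λ k → κ * (k * k)) (length-integers n) ⟨
    κ * (I * I)              ∎)
  where
  open ≡-Reasoning
  I  = length (integers (suc n))
  L  = length (strings n)
  κ′ = count (λ x y → agree? (suc n) m (toℕ x) (toℕ y)) (integers (suc n)) (integers (suc n))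
  κ  = count (avoids? m) (strings n) (strings n)
  regroup : ∀ c L → 4 * c * (L * L) ≡ c * ((L + L) * (L + L))
  regroup = solve-∀
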